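{- Let $q$ be an odd prime power, $t\geq 3$, $n=2t$, and let $h\in\mathbb{F}_{q^n}\setminus\mathbb{F}_{q^t}$ with $h^{q^t+1}=-1$. Let $\psi_{h,t}(x)= x^{q}+x^{q^{t-1}}-h^{1-q^{t+1}}x^{q^{t+1}}+h^{1-q^{2t-1}}x^{q^{2t-1}}$, let $\hat\psi_{h,t}$ be its adjoint map, $\mathcal{C}_{h,t}=\{ax+b\psi_{h,t}(x):a,b\in\mathbb{F}_{q^n}\}$ and $\hat{\mathcal{C}}_{h,t}=\{ax+b\hat\psi_{h,t}(x):a,b\in\mathbb{F}_{q^n}\}$. Then $\hat{\mathcal{C}}_{h,t}$ is equivalent to $\mathcal{C}_{h,t}$.
   Context: For a $q$-polynomial $f(x)=\sum_{i=0}^{n-1}a_ix^{q^i}$ over $\mathbb{F}_{q^n}$, its adjoint with respect to the bilinear form $\langle x,y\rangle=\mathrm{Tr}_{q^n/q}(xy)$ is $\hat f(x)=a_0x+\sum_{i=1}^{n-1}a_i^{q^{n-i}}x^{q^{n-i}}$. $q$-polynomials (modulo $x^{q^n}-x$) are identified with $\mathbb{F}_q$-linear maps of $\mathbb{F}_{q^n}$; for $\varphi=\sum a_ix^{q^i}$ and $\rho\in\operatorname{Aut}(\mathbb{F}_{q^n})$, $\varphi^\rho=\sum a_i^\rho x^{q^i}$. Two sets $\mathcal{C},\mathcal{C}'$ of $q$-polynomials are equivalent if there exist invertible $q$-polynomials $L_1,L_2$ and $\rho\in\operatorname{Aut}(\mathbb{F}_{q^n})$ with $\mathcal{C}'=\{L_1\circ\varphi^\rho\circ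 L_2:\varphi\in\mathcal{C}\}$. -}

module Defs where

open import Level using (Level; _⊔_)
open import Data.Nat as ℕ using (ℕ; zero; suc; _∸_; _≥_)
open import Data.Nat.Divisibility using (_∣_)
open import Data.Nat.Primality using (Prime)
open import Data.Fin using (Fin; toℕ)
open import Data.Fin.Base using (opposite; inject₁)
open import Data.Product using (Σ; ∃; _×_; _,_)
open import Relation.Nullary using (¬_; yes; no)
open import Relation.Binary.PropositionalEquality using (_≡_)
open import Algebra.Bundles using (CommutativeRing)
open import Algebra.Morphism.Structures using (module RingMorphisms)

IsPrimePower : ℕ → Set
IsPrimePower q = Σ ℕ λ p → Σ ℕ λ k → Prime p × k ≥ 1 × q ≡ p ℕ.^ k

IsOdd : ℕ → Set
IsOdd q = ¬ (2 ∣ q)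

-- (n - j) mod n for j : Fin n
negFin : ∀ {n} → Fin n → Fin n
negFin {suc m} Fin.zero    = Fin.zero
negFin {suc m} (Fin.suc i) = opposite (inject₁ i)

module FF {c ℓ : Level} (R : CommutativeRing c ℓ) where
  open CommutativeRing R

  pow : Carrier → ℕ → Carrier
  pow x zero    = 1#
  pow x (suc k) = x * pow x k

  ∑ : ∀ n → (Fin n → Carrier) → Carrier
  ∑ zero    f = 0#
  ∑ (suc n) f = f Fin.zero + ∑ n (λ i → f (Fin.suc i))

  IsFieldWithInv : (Carrier → Carrier) → Set (c ⊔ ℓ)
  IsFieldWithInv inv = (¬ (1# ≈ 0#)) × (∀ x → ¬ (x ≈ 0#) → x * inv x ≈ 1#)

  HasCardinality : ℕ → Set (c ⊔ ℓ)
  HasCardinality N = Σ (Fin N → Carrier) λ e →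
    (∀ i j → e i ≈ e j → i ≡ j) × (∀ x → ∃ λ i → e i ≈ x)

  -- q-polynomials over F_{q^n}, reduced mod x^{q^n} - x: coefficient vectors
  QPoly : ℕ → Set c
  QPoly n = Fin n → Carrier

  eval : (q n : ℕ) → QPoly n → Carrier → Carrier
  eval q n a x = ∑ n (λ i → a i * pow x (q ℕ.^ toℕ i))

  -- adjoint: hat f(x) = a_0 x + Σ_{i=1}^{n-1} a_i^{q^{n-i}} x^{q^{n-i}};
  -- coefficient of x^{q^j} is a_{(n-j) mod n}^{q^j}
  adjoint : (q n : ℕ) → QPoly n → QPoly n
  adjoint q n a j = pow (a (negFin j)) (q ℕ.^ toℕ j)

  applyAut : ∀ {n} → (Carrier → Carrier) → QPoly n → QPoly n
  applyAut ρ a i = ρ (a i)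

  lin : ∀ {n} → Carrier → Carrier → QPoly n → QPoly n
  lin a b φ Fin.zero    = a + b * φ Fin.zero
  lin a b φ (Fin.suc i) = b * φ (Fin.suc i)

  Invertible : (q n : ℕ) → QPoly n → Set (c ⊔ ℓ)
  Invertible q n L =
    (∀ x y → eval q n L x ≈ eval q n L y → x ≈ y) ×
    (∀ y → ∃ λ x → eval q n L x ≈ y)

  IsAut : (Carrier → Carrier) → Set (c ⊔ ℓ)
  IsAut ρ = RingMorphisms.IsRingIsomorphism rawRing rawRing ρ

  SameMap : (q n : ℕ) → QPoly n → QPoly n → Set (c ⊔ ℓ)
  SameMap q n f g = ∀ x → eval q n f x ≈ eval q n g x

  Equivalent : (q n : ℕ) → (QPoly n → Set (c ⊔ ℓ)) → (QPoly n → Set (c ⊔ ℓ)) → Set (c ⊔ ℓ)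
  Equivalent q n C C' = Σ (QPoly n) λ L₁ → Σ (QPoly n) λ L₂ → Σ (Carrier → Carrier) λ ρ →
    Invertible q n L₁ × Invertible q n L₂ × IsAut ρ ×
    (∀ φ → C φ → Σ (QPoly n) λ φ' → C' φ' ×
        (∀ x → eval q n φ' x ≈ eval q n L₁ (eval q n (applyAut ρ φ) (eval q n L₂ x)))) ×
    (∀ φ' → C' φ' → Σ (QPoly n) λ φ → C φ ×
        (∀ x → eval q n φ' x ≈ eval q n L₁ (eval q n (applyAut ρ φ) (eval q n L₂ x))))

  Span : (q n : ℕ) → QPoly n → QPoly n → Set (c ⊔ ℓ)
  Span q n φ f = Σ Carrier λ a → Σ Carrier λ b → SameMap q n f (lin a b φ)

  at : ℕ → ℕ → Carrier → Carrier
  at i k v with i ℕ.≟ k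
  ... | yes _ = v
  ... | no  _ = 0#

  -- ψ_{h,t}(x) = x^q + x^{q^{t-1}} - h^{1-q^{t+1}} x^{q^{t+1}} + h^{1-q^{2t-1}} x^{q^{2t-1}},
  -- with h^{1-m} := h * inv (h^m)
  psi : (inv : Carrier → Carrier) (q t : ℕ) → Carrier → QPoly (2 ℕ.* t)
  psi inv q t h i =
    at (toℕ i) 1 1# + at (toℕ i) (t ∸ 1) 1#
    + at (toℕ i) (t ℕ.+ 1) (- (h * inv (pow h (q ℕ.^ (t ℕ.+ 1)))))
    + at (toℕ i) (2 ℕ.* t ∸ 1) (h * inv (pow h (q ℕ.^ (2 ℕ.* t ∸ 1))))

{-# OPTIONS --safe #-}

-- Put k = 1 / h and b = k / (k^(q^(2t-1)) - h^q). Then ψ̂ (b ψ(x)) = c x with c = k (h^q - k^(q^(2t-1))), whence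
-- (a x + d ψ̂) ∘ (b ψ) = d c x + a b ψ, and the set of all a x + d ψ̂ is carried onto that of all a x + d ψ by
-- composition with b ψ on the right. The number b is defined and c ≠ 0 because h^(q²) ≠ 1 / h. The identity for
-- ψ̂ (b ψ(x)) only uses that x ↦ x^q and x ↦ x^(q^t) are commuting automorphisms, the latter an involution sending
-- h to - k; it becomes short once ψ̂(y) is grouped as
--   (h k^(q^(2t-1)) y + y^(q^t))^q + (y + (h h^q y)^(q^t))^(q^(2t-1)).

module Submission where

open import Defs
open import Level using (Level)
open import Data.Empty using (⊥)
open import Data.Nat as ℕ using (ℕ; zero; suc; _∸_; _≤_; _<_; _≥_; z≤n; s≤s; _!)
import Data.Nat.Properties as ℕ
open import Data.Nat.Combinatorics using (_C_; nCk≡n!/k![n-k]!; k![n∸k]!∣n!; nCn≡1)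
open import Data.Nat.Divisibility using (_∣_; divides; ∣⇒≤; ∣-refl; ∣m⇒∣m*n; ∣1⇒≡1)
open import Data.Nat.DivMod using (m/n*n≡m)
open import Data.Nat.Primality using (Prime; euclidsLemma; prime⇒nonZero; ¬prime[0]; ¬prime[1])
open import Data.Nat.Tactic.RingSolver using (solve-∀)
open import Data.Fin as Fin using (Fin; toℕ; fromℕ; punchIn; punchOut)
import Data.Fin.Properties as Fin
open import Data.Fin.Permutation using (Permutation′; permutation; _⟨$⟩ʳ_)
open import Data.Product using (∃; _×_; _,_; proj₁; proj₂)
open import Data.Sum using (_⊎_; inj₁; inj₂)
open import Data.Vec.Functional using (Vector; replicate)
open import Function using (_∘_; id)
open import Function.Definitions using (Injective)
open import Relation.Nullary using (¬_; Dec; yes; no; contradiction)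
import Relation.Nullary.Decidable as Dec
open import Relation.Binary.PropositionalEquality as ≡ using (_≡_; _≢_)
open import Algebra.Bundles using (CommutativeMonoid; CommutativeRing)
open import Algebra.Morphism.Construct.Identity using (isRingIsomorphism)
open import Algebra.Morphism.Structures using (module RingMorphisms)
open RingMorphisms using (IsRingHomomorphism)

-- Origin of b: put y = b ψ(x) and write σ, τ, γ for the powers q, q^(2t-1), q^t. The terms in σ x
-- and σ (γ x) of h τ k y + γ y have to vanish, so that the outer σ meets only values of its inverse
-- τ. Both conditions amount to γ b = - h² σ h τ k b, which fixes b up to a factor from the subfield
-- of order q^t. The denominator τ k - σ h is suited to this because γ sends it to σ k - τ h, which
-- is τ k - σ h divided by σ h τ k. The factor is chosen so that the surviving coefficient of τ (γ
-- x) is 1. The two groups then yield γ x + k σ h x and - (γ x + k τ k x), whose sum is a multiple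
-- of x. The field is given only as a commutative ring with inverses and an enumeration of its q^n
-- elements. Characteristic p, additivity of x ↦ x^q and x^(q^n) = x are therefore all drawn from
-- counting and from q being a prime power.

-- Binomial coefficients modulo a prime, finite pigeonhole, one-term sums.

prime∤! : ∀ {p} → Prime p → ∀ {m} → m < p → ¬ p ∣ m !
prime∤! pp {zero}  _   p∣1 = contradiction (≡.subst Prime (∣1⇒≡1 p∣1) pp) ¬prime[1]
prime∤! pp {suc m} m<p p∣m! with euclidsLemma (suc m) (m !) pp p∣m!
... | inj₁ p∣m  = ℕ.<⇒≱ m<p (∣⇒≤ p∣m)
... | inj₂ p∣m! = prime∤! pp (ℕ.<-trans (ℕ.n<1+n m) m<p) p∣m!

-- Multiplied out so that no division of naturals remains and Euclid's lemma applies to the left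
-- side.
nCk*[k!*[n∸k]!]≡n! : ∀ {n k} → k ≤ n → (n C k) ℕ.* (k ! ℕ.* (n ∸ k) !) ≡ n !
nCk*[k!*[n∸k]!]≡n! {n} {k} k≤n =
  ≡.trans (≡.cong (ℕ._* (k ! ℕ.* (n ∸ k) !)) (nCk≡n!/k![n-k]! k≤n))
          (m/n*n≡m {{k ℕ.!* (n ∸ k) !≢0}} (k![n∸k]!∣n! k≤n))

n∣n! : ∀ n → .{{ℕ.NonZero n}} → n ∣ n !
n∣n! (suc n) = ∣m⇒∣m*n (n !) ∣-refl

-- The prime divides p! = C · k! · (p - k)!, but neither factorial, since both arguments are below
-- p.
prime∣C : ∀ {p k} → Prime p → 0 < k → k < p → p ∣ p C k
prime∣C {p} {k} pp 0<k k<p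
  with euclidsLemma (p C k) (k ! ℕ.* (p ∸ k) !) pp
         (≡.subst (p ∣_) (≡.sym (nCk*[k!*[n∸k]!]≡n! (ℕ.<⇒≤ k<p))) (n∣n! p {{prime⇒nonZero pp}}))
... | inj₁ p∣C = p∣C
... | inj₂ p∣k!*j! with euclidsLemma (k !) ((p ∸ k) !) pp p∣k!*j!
...   | inj₁ p∣k! = contradiction p∣k! (prime∤! pp k<p)
...   | inj₂ p∣j! = contradiction p∣j! (prime∤! pp (ℕ.∸-monoʳ-< 0<k (ℕ.<⇒≤ k<p)))

even⊎odd : ∀ n → (∃ λ m → n ≡ 2 ℕ.* m) ⊎ (∃ λ m → n ≡ suc (2 ℕ.* m))
even⊎odd zero = inj₁ (0 , ≡.refl)
even⊎odd (suc n) with even⊎odd n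
... | inj₁ (m , ≡.refl) = inj₂ (m , ≡.refl)
... | inj₂ (m , ≡.refl) = inj₁ (suc m , ≡.sym (ℕ.*-suc 2 m))

-- Pigeonhole: punching a missed value out of the codomain would leave an injection from
-- `Fin (suc n)` into `Fin n`.
Fin-injective⇒surjective : ∀ {n} {f : Fin n → Fin n} → Injective _≡_ _≡_ f → ∀ j → ∃ λ i → f i ≡ j
Fin-injective⇒surjective {suc n} {f} inj j with Fin.any? (λ i → f i Fin.≟ j)
... | yes hit = hit
... | no miss = contradiction
  (Fin.injective⇒≤ {f = λ i → punchOut (λ j≡fi → miss (i , ≡.sym j≡fi))}
    (λ eq → inj (Fin.punchOut-injective {i = j} _ _ eq)))
  ℕ.1+n≰n

module _ {c ℓ} (M : CommutativeMonoid c ℓ) where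
  open CommutativeMonoid M
  open import Algebra.Properties.CommutativeMonoid.Sum M

  -- Stated for any commutative monoid because it serves both additively, for binomial and
  -- coefficient sums, and multiplicatively, for a product over the field.
  sum-supported-at : ∀ {n} (i : Fin n) (f : Vector Carrier n) → (∀ j → j ≢ i → f j ≈ ε) → sum f ≈ f i
  sum-supported-at {suc n} i f f≈ε = trans (sum-remove f)
    (trans (∙-congˡ (trans (sum-cong-≋ (λ j → f≈ε (punchIn i j) (Fin.punchInᵢ≢i i j)))
                           (sum-replicate-zero n)))
           (identityʳ _))

-- Finite fields given by an enumeration: integral domain, N · 1 = 0 and x^N = x.

module FiniteField {c ℓ : Level} (R : CommutativeRing c ℓ)
  (inv : CommutativeRing.Carrier R → CommutativeRing.Carrier R)
  (isField : FF.IsFieldWithInv R inv) {N : ℕ} (card : FF.HasCardinality R N) where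

  open CommutativeRing R
  open FF R
  open import Algebra.Properties.Ring ring
  open import Algebra.Properties.CommutativeSemiring.Exp commutativeSemiring
  open import Algebra.Properties.Semiring.Mult semiring using (×1-homo-*; ×-assoc-*; ×-congʳ)
    renaming (_×_ to _·_)
  import Algebra.Properties.CommutativeMonoid.Sum +-commutativeMonoid as Sum
  import Algebra.Properties.CommutativeMonoid.Sum *-commutativeMonoid as Prod
  open import Relation.Binary.Reasoning.Setoid setoid

  element : Fin N → Carrier
  element = proj₁ card

  index : Carrier → Fin N
  index x = proj₁ (proj₂ (proj₂ card) x)

  element-index : ∀ x → element (index x) ≈ x
  element-index x = proj₂ (proj₂ (proj₂ card) x)

  element-injective : ∀ {i j} → element i ≈ element j → i ≡ j
  element-injective = proj₁ (proj₂ card) _ _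

  index-cong : ∀ {x y} → x ≈ y → index x ≡ index y
  index-cong x≈y = element-injective (trans (element-index _) (trans x≈y (sym (element-index _))))

  -- The enumeration makes equality decidable; this is what allows x y = 0 to be split
  -- constructively into two cases.
  _≈?_ : ∀ x y → Dec (x ≈ y)
  x ≈? y = Dec.map′
    (λ eq → trans (sym (element-index x)) (trans (reflexive (≡.cong element eq)) (element-index y)))
    index-cong (index x Fin.≟ index y)

  1≉0 : ¬ 1# ≈ 0#
  1≉0 = proj₁ isField

  *-inverseʳ : ∀ {x} → ¬ x ≈ 0# → x * inv x ≈ 1#
  *-inverseʳ = proj₂ isField _

  *-inverseˡ : ∀ {x} → ¬ x ≈ 0# → inv x * x ≈ 1#
  *-inverseˡ x≉0 = trans (*-comm _ _) (*-inverseʳ x≉0)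

  *-cancelˡ-nonZero : ∀ {x y z} → ¬ x ≈ 0# → x * y ≈ x * z → y ≈ z
  *-cancelˡ-nonZero {x} {y} {z} x≉0 xy≈xz = begin
    y                ≈⟨ unscale y ⟨
    inv x * (x * y)  ≈⟨ *-congˡ xy≈xz ⟩
    inv x * (x * z)  ≈⟨ unscale z ⟩
    z                ∎
    where
    unscale : ∀ w → inv x * (x * w) ≈ w
    unscale w = trans (sym (*-assoc _ _ _)) (trans (*-congʳ (*-inverseˡ x≉0)) (*-identityˡ w))

  x*y≈0⇒x≈0∨y≈0 : ∀ {x y} → x * y ≈ 0# → x ≈ 0# ⊎ y ≈ 0#
  x*y≈0⇒x≈0∨y≈0 {x} xy≈0 with x ≈? 0#
  ... | yes x≈0 = inj₁ x≈0
  ... | no  x≉0 = inj₂ (*-cancelˡ-nonZero x≉0 (trans xy≈0 (sym (zeroʳ x))))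

  x^n≈0⇒x≈0 : ∀ {x} n → x ^ n ≈ 0# → x ≈ 0#
  x^n≈0⇒x≈0 zero    1≈0  = contradiction 1≈0 1≉0
  x^n≈0⇒x≈0 (suc n) xⁿ≈0 with x*y≈0⇒x≈0∨y≈0 xⁿ≈0
  ... | inj₁ x≈0   = x≈0
  ... | inj₂ xⁿ′≈0 = x^n≈0⇒x≈0 n xⁿ′≈0

  x²≈1⇒x≈±1 : ∀ {x} → x * x ≈ 1# → x ≈ 1# ⊎ x ≈ - 1#
  x²≈1⇒x≈±1 {x} x²≈1 with x*y≈0⇒x≈0∨y≈0 {x + - 1#} {x + 1#} (begin
    (x + - 1#) * (x + 1#)              ≈⟨ distribˡ _ _ _ ⟩
    (x + - 1#) * x + (x + - 1#) * 1#   ≈⟨ +-cong (distribʳ _ _ _) (*-identityʳ _) ⟩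
    x * x + - 1# * x + (x + - 1#)      ≈⟨ +-congʳ (+-cong x²≈1 (-1*x≈-x x)) ⟩
    1# + - x + (x + - 1#)              ≈⟨ +-assoc _ _ _ ⟩
    1# + (- x + (x + - 1#))            ≈⟨ +-congˡ (+-assoc _ _ _) ⟨
    1# + (- x + x + - 1#)              ≈⟨ +-congˡ (trans (+-congʳ (-‿inverseˡ x)) (+-identityˡ _)) ⟩
    1# + - 1#                          ≈⟨ -‿inverseʳ 1# ⟩
    0#                                 ∎)
  ... | inj₁ x-1≈0 = inj₁ (x-y≈0⇒x≈y x-1≈0)
    where
    x-y≈0⇒x≈y : ∀ {x y} → x + - y ≈ 0# → x ≈ y
    x-y≈0⇒x≈y eq = trans (+-inverseˡ-unique _ _ eq) (-‿involutive _)
  ... | inj₂ x+1≈0 = inj₂ (+-inverseˡ-unique _ _ x+1≈0)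

  injective⇒surjective : ∀ {f : Carrier → Carrier} →
    (∀ {x y} → x ≈ y → f x ≈ f y) → (∀ {x y} → f x ≈ f y → x ≈ y) → ∀ y → ∃ λ x → f x ≈ y
  injective⇒surjective {f} f-cong f-inj y =
    let i , eq = Fin-injective⇒surjective
          (λ eq → element-injective (f-inj (trans (sym (element-index _))
                    (trans (reflexive (≡.cong element eq)) (element-index _)))))
          (index y)
    in element i , trans (sym (element-index _)) (trans (reflexive (≡.cong element eq)) (element-index y))

  -- Reindexing of sums and products is by permutations of `Fin N`, so a bijection of the field is
  -- carried over to indices. It is applied to translation by 1 and to scaling by a nonzero x.
  conjugate : ∀ {f g : Carrier → Carrier} →
    (∀ {x y} → x ≈ y → f x ≈ f y) → (∀ {x y} → x ≈ y → g x ≈ g y) →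
    (∀ x → f (g x) ≈ x) → (∀ x → g (f x) ≈ x) → Permutation′ N
  conjugate {f} {g} f-cong g-cong fg gf = permutation (index ∘ f ∘ element) (index ∘ g ∘ element)
    (inverse f-cong fg) (inverse g-cong gf)
    where
    inverse : ∀ {f g : Carrier → Carrier} → (∀ {x y} → x ≈ y → f x ≈ f y) → (∀ x → f (g x) ≈ x) →
      ∀ i → index (f (element (index (g (element i))))) ≡ i
    inverse f-cong fg i = element-injective
      (trans (element-index _) (trans (f-cong (element-index _)) (fg _)))

  -- Both sides of Σ x = Σ (x + 1), the sums running over the whole field, cancel to N · 1 = 0.
  N·1≈0 : N · 1# ≈ 0#
  N·1≈0 = +-cancelˡ (Sum.sum element) _ _ (begin
    Sum.sum element + N · 1#
      ≈⟨ +-congˡ (Sum.sum-replicate N) ⟨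
    Sum.sum element + Sum.sum (replicate N 1#)
      ≈⟨ Sum.∑-distrib-+ element (replicate N 1#) ⟨
    Sum.sum (λ i → element i + 1#)
      ≈⟨ Sum.sum-cong-≋ {N} (λ i → element-index (element i + 1#)) ⟨
    Sum.sum (λ i → element (shift ⟨$⟩ʳ i))
      ≈⟨ Sum.sum-permute element shift ⟨
    Sum.sum element
      ≈⟨ +-identityʳ _ ⟨
    Sum.sum element + 0# ∎)
    where
    shift : Permutation′ N
    shift = conjugate {_+ 1#} {_+ - 1#} +-congʳ +-congʳ
      (λ x → trans (+-assoc _ _ _) (trans (+-congˡ (-‿inverseˡ 1#)) (+-identityʳ x)))
      (λ x → trans (+-assoc _ _ _) (trans (+-congˡ (-‿inverseʳ 1#)) (+-identityʳ x)))

  if0_then_else_ : Carrier → Carrier → Carrier → Carrier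
  if0 x then y else z with x ≈? 0#
  ... | yes _ = y
  ... | no  _ = z

  if0-yes : ∀ {x y z} → x ≈ 0# → if0 x then y else z ≈ y
  if0-yes {x} x≈0 with x ≈? 0#
  ... | yes _   = refl
  ... | no  x≉0 = contradiction x≈0 x≉0

  if0-no : ∀ {x y z} → ¬ x ≈ 0# → if0 x then y else z ≈ z
  if0-no {x} x≉0 with x ≈? 0#
  ... | yes x≈0 = contradiction x≈0 x≉0
  ... | no  _   = refl

  -- For x ≠ 0 put f y = y for y ≠ 0 and f 0 = 1, the product Π f is nonzero and
  -- invariant under y ↦ x y, so Π g = 1 where g y = x for y ≠ 0 and g 0 = 1; supplying the missing
  -- factor x at 0 turns Π g into x ^ N.
  x^N≈x : ∀ x → x ^ N ≈ x
  x^N≈x x with x ≈? 0#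
  ... | yes x≈0 = trans (^-congˡ N x≈0) (trans (0^N (index 0#)) (sym x≈0))
    where
    -- The index only witnesses that the exponent is positive, since `0# ^ 0` is 1.
    0^N : ∀ {n} → Fin n → 0# ^ n ≈ 0#
    0^N {suc n} _ = zeroˡ _
  ... | no  x≉0 = begin
    x ^ N                                              ≈⟨ Prod.sum-replicate N ⟨
    Prod.sum (replicate N x)                           ≈⟨ Prod.sum-cong-≋ g*d≈x ⟨
    Prod.sum (λ i → g i * d i)                         ≈⟨ Prod.∑-distrib-+ g d ⟩
    Prod.sum g * Prod.sum d                            ≈⟨ *-cong Πg≈1 Πd≈x ⟩
    1# * x                                             ≈⟨ *-identityˡ x ⟩
    x                                                  ∎
    where
    f g d : Fin N → Carrier
    f i = if0 element i then 1# else element i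
    g i = if0 element i then 1# else x
    d i = if0 element i then x else 1#

    g*d≈x : ∀ i → g i * d i ≈ x
    g*d≈x i with element i ≈? 0#
    ... | yes _ = *-identityˡ x
    ... | no  _ = *-identityʳ x

    scale : Permutation′ N
    scale = conjugate {x *_} {inv x *_} *-congˡ *-congˡ
      (λ y → trans (sym (*-assoc _ _ _)) (trans (*-congʳ (*-inverseʳ x≉0)) (*-identityˡ y)))
      (λ y → trans (sym (*-assoc _ _ _)) (trans (*-congʳ (*-inverseˡ x≉0)) (*-identityˡ y)))

    f-scale : ∀ i → f (scale ⟨$⟩ʳ i) ≈ g i * f i
    f-scale i with element i ≈? 0#
    ... | yes y≈0 = trans (if0-yes (trans (element-index _) (trans (*-congˡ y≈0) (zeroʳ x))))
                          (sym (*-identityˡ 1#))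
    ... | no  y≉0 = trans (if0-no λ xy≈0 → y≉0 (*-cancelˡ-nonZero x≉0
                            (trans (trans (sym (element-index _)) xy≈0) (sym (zeroʳ x)))))
                          (element-index _)

    Π≉0 : ∀ {n} (g : Fin n → Carrier) → (∀ i → ¬ g i ≈ 0#) → ¬ Prod.sum g ≈ 0#
    Π≉0 {zero}  g g≉0 1≈0 = 1≉0 1≈0
    Π≉0 {suc n} g g≉0 Π≈0 with x*y≈0⇒x≈0∨y≈0 Π≈0
    ... | inj₁ g₀≈0 = g≉0 Fin.zero g₀≈0
    ... | inj₂ Π′≈0 = Π≉0 (g ∘ Fin.suc) (g≉0 ∘ Fin.suc) Π′≈0

    f≉0 : ∀ i → ¬ f i ≈ 0#
    f≉0 i with element i ≈? 0#
    ... | yes _   = 1≉0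
    ... | no  y≉0 = y≉0

    Πg≈1 : Prod.sum g ≈ 1#
    Πg≈1 = *-cancelˡ-nonZero (Π≉0 f f≉0) (begin
      Prod.sum f * Prod.sum g            ≈⟨ *-comm _ _ ⟩
      Prod.sum g * Prod.sum f            ≈⟨ Prod.∑-distrib-+ g f ⟨
      Prod.sum (λ i → g i * f i)         ≈⟨ Prod.sum-cong-≋ f-scale ⟨
      Prod.sum (λ i → f (scale ⟨$⟩ʳ i))  ≈⟨ Prod.sum-permute f scale ⟨
      Prod.sum f                         ≈⟨ *-identityʳ _ ⟨
      Prod.sum f * 1#                    ∎)

    Πd≈x : Prod.sum d ≈ x
    Πd≈x = trans
      (sum-supported-at *-commutativeMonoid (index 0#) d λ j j≢0 → if0-no λ e≈0 →
        j≢0 (element-injective (trans e≈0 (sym (element-index 0#)))))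
      (if0-yes (element-index 0#))

  -- Characteristic p and the Frobenius powers as ring homomorphisms.

  module Frobenius {p m : ℕ} (pp : Prime p) (N≡p^m : N ≡ p ℕ.^ m) where

    open import Algebra.Properties.CommutativeSemiring.Binomial commutativeSemiring
      using (binomialTerm) renaming (theorem to binomial-theorem)

    -- Multiples of 1 multiply like the integers, so 0 = N · 1 = (p · 1)^m, and a field has no
    -- nonzero nilpotents.
    p·1≈0 : p · 1# ≈ 0#
    p·1≈0 = x^n≈0⇒x≈0 m (trans (sym (p^j·1 m)) (≡.subst (λ n → n · 1# ≈ 0#) N≡p^m N·1≈0))
      where
      p^j·1 : ∀ j → (p ℕ.^ j) · 1# ≈ (p · 1#) ^ j
      p^j·1 zero    = +-identityʳ 1#
      p^j·1 (suc j) = trans (×1-homo-* p (p ℕ.^ j)) (*-congˡ (p^j·1 j))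

    p∣n⇒n·x≈0 : ∀ {n} → p ∣ n → ∀ x → n · x ≈ 0#
    p∣n⇒n·x≈0 (divides d ≡.refl) x = begin
      (d ℕ.* p) · x              ≈⟨ ×-congʳ (d ℕ.* p) (*-identityˡ x) ⟨
      (d ℕ.* p) · (1# * x)       ≈⟨ ×-assoc-* (d ℕ.* p) 1# x ⟨
      (d ℕ.* p) · 1# * x         ≈⟨ *-congʳ (×1-homo-* d p) ⟩
      (d · 1#) * (p · 1#) * x    ≈⟨ *-congʳ (trans (*-congˡ p·1≈0) (zeroʳ _)) ⟩
      0# * x                     ≈⟨ zeroˡ x ⟩
      0#                         ∎

    -- The inner binomial coefficients are divisible by p and act as zero; only the two end terms
    -- survive.
    ^p-homo-+ : ∀ x y → (x + y) ^ p ≈ x ^ p + y ^ p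
    ^p-homo-+ x y = binomial p pp ≡.refl
      where
      -- A separate exponent `r` can be matched as `suc r′`, which gives the last term the index
      -- `fromℕ r′`.
      binomial : ∀ r → Prime r → r ≡ p → (x + y) ^ r ≈ x ^ r + y ^ r
      binomial zero    pr _ = contradiction pr ¬prime[0]
      binomial r@(suc r′) pr ≡.refl = begin
        (x + y) ^ r
          ≈⟨ binomial-theorem r x y ⟩
        term Fin.zero + Sum.sum (term ∘ Fin.suc)
          ≈⟨ +-cong first (trans (sum-supported-at +-commutativeMonoid (fromℕ r′) _ middle) last) ⟩
        y ^ r + x ^ r
          ≈⟨ +-comm _ _ ⟩
        x ^ r + y ^ r ∎
        where
        term : Fin (suc r) → Carrier
        term = binomialTerm x y r

        first : term Fin.zero ≈ y ^ r
        first = trans (+-identityʳ _) (*-identityˡ _)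

        middle : ∀ j → j ≢ fromℕ r′ → term (Fin.suc j) ≈ 0#
        middle j j≢r′ = p∣n⇒n·x≈0 (prime∣C pr (s≤s z≤n) (s≤s (ℕ.≤∧≢⇒< (ℕ.≤-pred (Fin.toℕ<n j))
          λ eq → j≢r′ (Fin.toℕ-injective (≡.trans eq (≡.sym (Fin.toℕ-fromℕ r′))))))) _

        last : term (Fin.suc (fromℕ r′)) ≈ x ^ r
        last rewrite Fin.toℕ-fromℕ r′ | nCn≡1 r | ℕ.n∸n≡0 r′ = trans (+-identityʳ _) (*-identityʳ _)

    ^p^-homo-+ : ∀ j x y → (x + y) ^ (p ℕ.^ j) ≈ x ^ (p ℕ.^ j) + y ^ (p ℕ.^ j)
    ^p^-homo-+ zero    x y = trans (*-identityʳ _) (sym (+-cong (*-identityʳ x) (*-identityʳ y)))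
    ^p^-homo-+ (suc j) x y = begin
      (x + y) ^ (p ℕ.* p ℕ.^ j)                      ≈⟨ ^-assocʳ _ p _ ⟨
      ((x + y) ^ p) ^ (p ℕ.^ j)                      ≈⟨ ^-congˡ (p ℕ.^ j) (^p-homo-+ x y) ⟩
      (x ^ p + y ^ p) ^ (p ℕ.^ j)                    ≈⟨ ^p^-homo-+ j _ _ ⟩
      (x ^ p) ^ (p ℕ.^ j) + (y ^ p) ^ (p ℕ.^ j)      ≈⟨ +-cong (^-assocʳ x p _) (^-assocʳ y p _) ⟩
      x ^ (p ℕ.* p ℕ.^ j) + y ^ (p ℕ.* p ℕ.^ j)      ∎

    0^p^≈0 : ∀ j → 0# ^ (p ℕ.^ j) ≈ 0#
    0^p^≈0 j with p ℕ.^ j | ℕ.m^n>0 p {{prime⇒nonZero pp}} j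
    ... | suc _ | _ = zeroˡ _

    ^p^-isRingHomomorphism : ∀ j → IsRingHomomorphism rawRing rawRing (_^ (p ℕ.^ j))
    ^p^-isRingHomomorphism j = record
      { isSemiringHomomorphism = record
        { isNearSemiringHomomorphism = record
          { +-isMonoidHomomorphism = record
            { isMagmaHomomorphism = record
              { isRelHomomorphism = record { cong = ^-congˡ (p ℕ.^ j) }
              ; homo = ^p^-homo-+ j
              }
            ; ε-homo = 0^p^≈0 j
            }
          ; *-homo = λ x y → ^-distrib-* x y (p ℕ.^ j)
          }
        ; 1#-homo = 1^n (p ℕ.^ j)
        }
      ; -‿homo = λ x → +-inverseˡ-unique _ _ (begin
          (- x) ^ (p ℕ.^ j) + x ^ (p ℕ.^ j)  ≈⟨ ^p^-homo-+ j (- x) x ⟨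
          (- x + x) ^ (p ℕ.^ j)              ≈⟨ ^-congˡ (p ℕ.^ j) (-‿inverseˡ x) ⟩
          0# ^ (p ℕ.^ j)                     ≈⟨ 0^p^≈0 j ⟩
          0#                                 ∎)
      }
      where
      1^n : ∀ n → 1# ^ n ≈ 1#
      1^n zero    = refl
      1^n (suc n) = trans (*-identityˡ _) (1^n n)

    -- If 1 = -1 then 2 · 1 = 0, and p = 1 + 2d gives 0 = p · 1 = 1.
    1≉-1 : ¬ 2 ∣ p → ¬ 1# ≈ - 1#
    1≉-1 2∤p 1≈-1 with even⊎odd p
    ... | inj₁ (d , p≡2d)   = 2∤p (divides d (≡.trans p≡2d (ℕ.*-comm 2 d)))
    ... | inj₂ (d , p≡1+2d) = 1≉0 (begin
      1#                            ≈⟨ +-identityʳ 1# ⟨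
      1# + 0#                       ≈⟨ +-congˡ (zeroˡ (d · 1#)) ⟨
      1# + 0# * (d · 1#)            ≈⟨ +-congˡ (*-congʳ 2·1≈0) ⟨
      1# + (2 · 1#) * (d · 1#)      ≈⟨ +-congˡ (×1-homo-* 2 d) ⟨
      suc (2 ℕ.* d) · 1#            ≈⟨ ≡.subst (λ n → n · 1# ≈ 0#) p≡1+2d p·1≈0 ⟩
      0#                            ∎)
      where
      2·1≈0 : 2 · 1# ≈ 0#
      2·1≈0 = trans (+-cong 1≈-1 (+-identityʳ 1#)) (-‿inverseˡ 1#)

-- The composition identity for ψ̂ and b ψ, over abstract homomorphisms.

module _ {c ℓ} (R : CommutativeRing c ℓ) where
  open CommutativeRing R

  -- σ, τ = σ⁻¹ and γ stand for the maps x ↦ x^q, x ↦ x^(q^(2t-1)) and x ↦ x^(q^t), and k for 1 / h.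
  module TwistedInverse
    {σ τ γ : Carrier → Carrier}
    (σ-hom : IsRingHomomorphism rawRing rawRing σ)
    (τ-hom : IsRingHomomorphism rawRing rawRing τ)
    (γ-hom : IsRingHomomorphism rawRing rawRing γ)
    (στ : ∀ x → σ (τ x) ≈ x) (τσ : ∀ x → τ (σ x) ≈ x) (γγ : ∀ x → γ (γ x) ≈ x)
    (γσ : ∀ x → γ (σ x) ≈ σ (γ x)) (γτ : ∀ x → γ (τ x) ≈ τ (γ x))
    {h k β : Carrier} (hk≈1 : h * k ≈ 1#) (γh≈-k : γ h ≈ - k)
    (β-inverse : β * (τ k + - σ h) ≈ 1#) where

    private
      module σ = IsRingHomomorphism σ-hom
      module τ = IsRingHomomorphism τ-hom
      module γ = IsRingHomomorphism γ-hom
    open import Algebra.Properties.Ring ring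
    open import Algebra.Solver.Ring.NaturalCoefficients.Default commutativeSemiring
    open import Relation.Binary.Reasoning.Setoid setoid

    -- Here x^(q^(t+1)) is σ (γ x) and x^(q^(t-1)) is τ (γ x). From γ h = - k one gets h^(q^(t+1)) =
    -- - σ k, so that - h^(1-q^(t+1)) becomes h σ h.
    ψ : Carrier → Carrier
    ψ x = σ x + τ (γ x) + h * σ h * σ (γ x) + h * τ k * τ x

    -- The adjoint of v x^(q^i) is y ↦ (v y)^(q^(n-i)); keeping the coefficients inside the powers
    -- is what makes the grouping under σ and τ possible.
    ψ̂ : Carrier → Carrier
    ψ̂ y = τ y + σ (γ y) + τ (γ (h * σ h * y)) + σ (h * τ k * y)

    private
      -- The fractions σ h / (τ k - σ h) and τ k / (τ k - σ h). They differ by 1 and γ sends each to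
      -- minus the other; the cancellations below rest on these two facts.
      f g : Carrier
      f = σ h * β
      g = τ k * β

      -- This is - γ y for y = k β ψ(x), the part that cancels in both groups.
      V : Carrier → Carrier
      V x = h * τ k * f * (σ (γ x) + τ x) + g * σ x + f * τ (γ x)

      hom-inverse : ∀ {φ} → IsRingHomomorphism rawRing rawRing φ → φ h * φ k ≈ 1#
      hom-inverse φ-hom = trans (sym (φ.*-homo h k)) (trans (φ.⟦⟧-cong hk≈1) φ.1#-homo)
        where module φ = IsRingHomomorphism φ-hom

      γk≈-h : γ k ≈ - h
      γk≈-h = begin
        γ k                ≈⟨ *-identityˡ _ ⟨
        1# * γ k           ≈⟨ *-congʳ hk≈1 ⟨
        h * k * γ k        ≈⟨ *-assoc _ _ _ ⟩
        h * (k * γ k)      ≈⟨ *-congˡ (trans (sym (-‿involutive _)) (-‿cong (-‿distribˡ-* k (γ k)))) ⟩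
        h * - (- k * γ k)  ≈⟨ *-congˡ (-‿cong (trans (*-congʳ (sym γh≈-k)) (hom-inverse γ-hom))) ⟩
        h * - 1#           ≈⟨ trans (*-comm _ _) (-1*x≈-x h) ⟩
        - h                ∎

      γσh≈-σk : γ (σ h) ≈ - σ k
      γσh≈-σk = trans (γσ h) (trans (σ.⟦⟧-cong γh≈-k) (σ.-‿homo k))

      γτk≈-τh : γ (τ k) ≈ - τ h
      γτk≈-τh = trans (γτ k) (trans (τ.⟦⟧-cong γk≈-h) (τ.-‿homo h))

      g≈1+f : g ≈ 1# + f
      g≈1+f = begin
        τ k * β                              ≈⟨ +-identityʳ _ ⟨
        τ k * β + 0#                         ≈⟨ +-congˡ (-‿inverseˡ f) ⟨
        τ k * β + (- (σ h * β) + σ h * β)    ≈⟨ +-assoc _ _ _ ⟨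
        τ k * β + - (σ h * β) + σ h * β      ≈⟨ +-congʳ (+-congˡ (-‿distribˡ-* (σ h) β)) ⟩
        τ k * β + - σ h * β + σ h * β        ≈⟨ +-congʳ (trans (sym (distribʳ β _ _)) (*-comm _ β)) ⟩
        β * (τ k + - σ h) + σ h * β          ≈⟨ +-congʳ β-inverse ⟩
        1# + f                               ∎

      -- Because σ h σ k = τ h τ k = 1, the image σ k - τ h of τ k - σ h under γ equals (τ k - σ h)
      -- / (σ h τ k). Both sides are thus inverse to σ k - τ h.
      γβ≈ : γ β ≈ σ h * τ k * β
      γβ≈ = begin
        γ β                                          ≈⟨ *-identityʳ _ ⟨
        γ β * 1#                                     ≈⟨ *-congˡ 1≈ ⟩
        γ β * ((σ h * τ k * β) * (σ k + - τ h))      ≈⟨ solve 3 (λ a b c → a :* (b :* c) := b :* (a :* c)) refl _ _ _ ⟩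
        (σ h * τ k * β) * (γ β * (σ k + - τ h))      ≈⟨ *-congˡ γ-inverse ⟩
        (σ h * τ k * β) * 1#                         ≈⟨ *-identityʳ _ ⟩
        σ h * τ k * β                                ∎
        where
        γ-inverse : γ β * (σ k + - τ h) ≈ 1#
        γ-inverse = begin
          γ β * (σ k + - τ h)          ≈⟨ *-congˡ (+-comm _ _) ⟩
          γ β * (- τ h + σ k)          ≈⟨ *-congˡ (+-cong γτk≈-τh (trans (-‿cong γσh≈-σk) (-‿involutive _))) ⟨
          γ β * (γ (τ k) + - γ (σ h))  ≈⟨ *-congˡ (trans (γ.+-homo _ _) (+-congˡ (γ.-‿homo _))) ⟨
          γ β * γ (τ k + - σ h)        ≈⟨ γ.*-homo _ _ ⟨
          γ (β * (τ k + - σ h))        ≈⟨ γ.⟦⟧-cong β-inverse ⟩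
          γ 1#                         ≈⟨ γ.1#-homo ⟩
          1#                           ∎

        1≈ : 1# ≈ (σ h * τ k * β) * (σ k + - τ h)
        1≈ = begin
          1#
            ≈⟨ β-inverse ⟨
          β * (τ k + - σ h)
            ≈⟨ *-congˡ (+-cong (*-identityˡ _) (-‿cong (*-identityˡ _))) ⟨
          β * (1# * τ k + - (1# * σ h))
            ≈⟨ *-congˡ (+-cong (*-congʳ (hom-inverse σ-hom)) (-‿cong (*-congʳ (hom-inverse τ-hom)))) ⟨
          β * (σ h * σ k * τ k + - (τ h * τ k * σ h))
            ≈⟨ *-congˡ (+-congˡ (trans (-‿distribˡ-* _ _) (*-congʳ (-‿distribˡ-* _ _)))) ⟩
          β * (σ h * σ k * τ k + - τ h * τ k * σ h)
            -- The solver is one for commutative semirings, so `- τ h` enters as an atom.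
            ≈⟨ solve 5 (λ β p p′ -r r′ → β :* (p :* p′ :* r′ :+ -r :* r′ :* p) := p :* r′ :* β :* (p′ :+ -r))
                 refl β (σ h) (σ k) (- τ h) (τ k) ⟩
          (σ h * τ k * β) * (σ k + - τ h) ∎

      -- The value is minus the coefficient of σ (γ x) in h τ k y, where y = k β ψ(x), so that this
      -- term disappears from h τ k y + γ y.
      γkβ≈ : γ (k * β) ≈ - (h * τ k * f)
      γkβ≈ = begin
        γ (k * β)                  ≈⟨ trans (γ.*-homo k β) (*-cong γk≈-h γβ≈) ⟩
        - h * (σ h * τ k * β)      ≈⟨ -‿distribˡ-* _ _ ⟨
        - (h * (σ h * τ k * β))    ≈⟨ -‿cong (solve 4 (λ h p r′ β → h :* (p :* r′ :* β) := h :* r′ :* (p :* β)) refl _ _ _ _) ⟩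
        - (h * τ k * f)            ∎

      γf≈-g : γ f ≈ - g
      γf≈-g = begin
        γ (σ h * β)                ≈⟨ trans (γ.*-homo _ β) (*-cong γσh≈-σk γβ≈) ⟩
        - σ k * (σ h * τ k * β)    ≈⟨ -‿distribˡ-* _ _ ⟨
        - (σ k * (σ h * τ k * β))  ≈⟨ -‿cong (solve 4 (λ p p′ r′ β → p′ :* (p :* r′ :* β) := p :* p′ :* (r′ :* β)) refl _ _ _ _) ⟩
        - (σ h * σ k * g)          ≈⟨ -‿cong (trans (*-congʳ (hom-inverse σ-hom)) (*-identityˡ g)) ⟩
        - g                        ∎

      γg≈-f : γ g ≈ - f
      γg≈-f = trans (sym (-‿involutive _)) (-‿cong
        (trans (trans (sym (γ.-‿homo g)) (γ.⟦⟧-cong (sym γf≈-g))) (γγ f)))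

      ψ-scaled : ∀ x → k * β * ψ x ≈ k * β * (σ x + τ (γ x)) + f * σ (γ x) + g * τ x
      ψ-scaled x = begin
        k * β * (σ x + τ (γ x) + h * σ h * σ (γ x) + h * τ k * τ x)
          ≈⟨ solve 9 (λ h k β p r′ A T′ A′ T →
               k :* β :* (A :+ T′ :+ h :* p :* A′ :+ h :* r′ :* T) :=
               k :* β :* (A :+ T′) :+ (h :* k) :* (p :* β :* A′ :+ r′ :* β :* T))
               refl h k β (σ h) (τ k) (σ x) (τ (γ x)) (σ (γ x)) (τ x) ⟩
        k * β * (σ x + τ (γ x)) + h * k * (f * σ (γ x) + g * τ x)
          ≈⟨ +-congˡ (trans (*-congʳ hk≈1) (*-identityˡ _)) ⟩
        k * β * (σ x + τ (γ x)) + (f * σ (γ x) + g * τ x)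
          ≈⟨ +-assoc _ _ _ ⟨
        k * β * (σ x + τ (γ x)) + f * σ (γ x) + g * τ x ∎

      γψ-scaled : ∀ x → γ (k * β * ψ x) ≈ - V x
      γψ-scaled x = begin
        γ (k * β * ψ x)
          ≈⟨ γ.⟦⟧-cong (ψ-scaled x) ⟩
        γ (k * β * (σ x + τ (γ x)) + f * σ (γ x) + g * τ x)
          ≈⟨ trans (γ.+-homo _ _) (+-congʳ (γ.+-homo _ _)) ⟩
        γ (k * β * (σ x + τ (γ x))) + γ (f * σ (γ x)) + γ (g * τ x)
          ≈⟨ +-cong (+-cong (γ.*-homo _ _) (γ.*-homo _ _)) (γ.*-homo _ _) ⟩
        γ (k * β) * γ (σ x + τ (γ x)) + γ f * γ (σ (γ x)) + γ g * γ (τ x)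
          ≈⟨ +-cong (+-cong
               (*-cong γkβ≈ (trans (γ.+-homo _ _) (+-cong (γσ x) (trans (γτ _) (τ.⟦⟧-cong (γγ x))))))
               (*-cong γf≈-g (trans (γσ _) (σ.⟦⟧-cong (γγ x)))))
               (*-cong γg≈-f (γτ x)) ⟩
        - (h * τ k * f) * (σ (γ x) + τ x) + - g * σ x + - f * τ (γ x)
          ≈⟨ +-cong (+-cong (-‿distribˡ-* _ _) (-‿distribˡ-* _ _)) (-‿distribˡ-* _ _) ⟨
        - (h * τ k * f * (σ (γ x) + τ x)) + - (g * σ x) + - (f * τ (γ x))
          ≈⟨ trans (+-congʳ (-‿+-comm _ _)) (-‿+-comm _ _) ⟩
        - V x ∎

      -- Adding γ y = - V x leaves only values of τ, which the outer σ of ψ̂ undoes.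
      first-half : ∀ x → h * τ k * (k * β * ψ x) ≈ V x + (τ (γ x) + h * τ k * τ x)
      first-half x = begin
        h * τ k * (k * β * ψ x)
          ≈⟨ *-congˡ (ψ-scaled x) ⟩
        h * τ k * (k * β * (σ x + τ (γ x)) + f * σ (γ x) + g * τ x)
          ≈⟨ solve 9 (λ h k β f r′ A T′ A′ T →
               h :* r′ :* (k :* β :* (A :+ T′) :+ f :* A′ :+ r′ :* β :* T) :=
               (h :* k) :* (r′ :* β :* (A :+ T′)) :+ (h :* r′ :* f :* A′ :+ r′ :* β :* (h :* r′ :* T)))
               refl h k β f (τ k) (σ x) (τ (γ x)) (σ (γ x)) (τ x) ⟩
        h * k * (g * (σ x + τ (γ x))) + (h * τ k * f * σ (γ x) + g * (h * τ k * τ x))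
          -- Here and in the next step `g` becomes `1# + f` in the coefficients of τ x and τ (γ x)
          -- alone: the summands 1 form the remainder, the summands `f` go into V.
          ≈⟨ +-cong (trans (*-congʳ hk≈1) (trans (*-identityˡ _) (distribˡ _ _ _))) (+-congˡ (*-congʳ g≈1+f)) ⟩
        g * σ x + g * τ (γ x) + (h * τ k * f * σ (γ x) + (1# + f) * (h * τ k * τ x))
          ≈⟨ +-congʳ (+-congˡ (*-congʳ g≈1+f)) ⟩
        g * σ x + (1# + f) * τ (γ x) + (h * τ k * f * σ (γ x) + (1# + f) * (h * τ k * τ x))
          ≈⟨ solve 8 (λ h f g r′ A T′ A′ T →
               g :* A :+ (con 1 :+ f) :* T′ :+ (h :* r′ :* f :* A′ :+ (con 1 :+ f) :* (h :* r′ :* T)) :=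
               h :* r′ :* f :* (A′ :+ T) :+ g :* A :+ f :* T′ :+ (T′ :+ h :* r′ :* T))
               refl h f g (τ k) (σ x) (τ (γ x)) (σ (γ x)) (τ x) ⟩
        V x + (τ (γ x) + h * τ k * τ x) ∎

      -- Since γ (h σ h) = k σ k, this makes y + γ (h σ h y) minus the remainder on the right, a
      -- combination of values of σ for the outer τ to undo.
      second-half : ∀ x → k * σ k * V x ≈ k * β * ψ x + (σ (γ x) + k * σ k * σ x)
      second-half x = begin
        k * σ k * V x
          ≈⟨ solve 11 (λ h k β p p′ r′ g A T′ A′ T →
               k :* p′ :* (h :* r′ :* (p :* β) :* (A′ :+ T) :+ g :* A :+ p :* β :* T′) :=
               (h :* k) :* ((p :* p′) :* (r′ :* β :* (A′ :+ T))) :+ g :* (k :* p′ :* A) :+ (p :* p′) :* (k :* β :* T′))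
               refl h k β (σ h) (σ k) (τ k) g (σ x) (τ (γ x)) (σ (γ x)) (τ x) ⟩
        h * k * (σ h * σ k * (g * (σ (γ x) + τ x))) + g * (k * σ k * σ x) + σ h * σ k * (k * β * τ (γ x))
          -- Mirror image of the first half: g = 1 + f now splits the coefficients of σ x and σ (γ
          -- x), and σ h σ k = 1 turns f k σ k into k β.
          ≈⟨ +-cong (+-cong (trans (*-congʳ hk≈1) (trans (*-identityˡ _) (trans (*-congʳ pp′≈1) (*-identityˡ _))))
                            (*-congʳ g≈1+f))
                    (trans (*-congʳ pp′≈1) (*-identityˡ _)) ⟩
        g * (σ (γ x) + τ x) + (1# + f) * (k * σ k * σ x) + k * β * τ (γ x)
          ≈⟨ solve 9 (λ k β p p′ g A T′ A′ T →
               g :* (A′ :+ T) :+ (con 1 :+ p :* β) :* (k :* p′ :* A) :+ k :* β :* T′ :=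
               g :* A′ :+ g :* T :+ k :* p′ :* A :+ (p :* p′) :* (k :* β :* A) :+ k :* β :* T′)
               refl k β (σ h) (σ k) g (σ x) (τ (γ x)) (σ (γ x)) (τ x) ⟩
        g * σ (γ x) + g * τ x + k * σ k * σ x + σ h * σ k * (k * β * σ x) + k * β * τ (γ x)
          ≈⟨ +-congʳ (+-cong (+-congʳ (+-congʳ (*-congʳ g≈1+f))) (trans (*-congʳ pp′≈1) (*-identityˡ _))) ⟩
        (1# + f) * σ (γ x) + g * τ x + k * σ k * σ x + k * β * σ x + k * β * τ (γ x)
          ≈⟨ solve 8 (λ kβ f g kp′ A T′ A′ T →
               (con 1 :+ f) :* A′ :+ g :* T :+ kp′ :* A :+ kβ :* A :+ kβ :* T′ :=
               kβ :* (A :+ T′) :+ f :* A′ :+ g :* T :+ (A′ :+ kp′ :* A))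
               refl (k * β) f g (k * σ k) (σ x) (τ (γ x)) (σ (γ x)) (τ x) ⟩
        k * β * (σ x + τ (γ x)) + f * σ (γ x) + g * τ x + (σ (γ x) + k * σ k * σ x)
          ≈⟨ +-congʳ (ψ-scaled x) ⟨
        k * β * ψ x + (σ (γ x) + k * σ k * σ x) ∎
        where
        pp′≈1 = hom-inverse σ-hom

      x+y-x≈y : ∀ x y → x + y + - x ≈ y
      x+y-x≈y x y = trans (+-congʳ (+-comm x y))
        (trans (+-assoc y x (- x)) (trans (+-congˡ (-‿inverseʳ x)) (+-identityʳ y)))

    ψ̂-kβψ : ∀ x → ψ̂ (k * β * ψ x) ≈ k * (σ h + - τ k) * x
    ψ̂-kβψ x = begin
      τ y + σ (γ y) + τ (γ (h * σ h * y)) + σ (h * τ k * y)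
        ≈⟨ solve 4 (λ a b c d → a :+ b :+ c :+ d := d :+ b :+ (a :+ c)) refl _ _ _ _ ⟩
      σ (h * τ k * y) + σ (γ y) + (τ y + τ (γ (h * σ h * y)))
        ≈⟨ +-cong (σ.+-homo _ _) (τ.+-homo _ _) ⟨
      σ (h * τ k * y + γ y) + τ (y + γ (h * σ h * y))
        ≈⟨ +-cong (σ.⟦⟧-cong hτky+γy) (τ.⟦⟧-cong y+γhσhy) ⟩
      σ (τ (γ x) + h * τ k * τ x) + τ (- (σ (γ x) + k * σ k * σ x))
        ≈⟨ +-cong σ-half (trans (τ.-‿homo _) (-‿cong τ-half)) ⟩
      γ x + σ h * k * x + - (γ x + τ k * k * x)
        ≈⟨ trans (+-congˡ (sym (-‿+-comm _ _))) (sym (+-assoc _ _ _)) ⟩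
      γ x + σ h * k * x + - γ x + - (τ k * k * x)
        ≈⟨ +-cong (x+y-x≈y (γ x) (σ h * k * x)) (trans (-‿distribˡ-* _ _) (*-congʳ (-‿distribˡ-* _ _))) ⟩
      σ h * k * x + - τ k * k * x
        ≈⟨ solve 4 (λ p r k x → p :* k :* x :+ r :* k :* x := k :* (p :+ r) :* x) refl (σ h) (- τ k) k x ⟩
      k * (σ h + - τ k) * x ∎
      where
      y = k * β * ψ x

      σ-half : σ (τ (γ x) + h * τ k * τ x) ≈ γ x + σ h * k * x
      σ-half = trans (σ.+-homo _ _) (+-cong (στ _) (trans (σ.*-homo _ _)
        (*-cong (trans (σ.*-homo _ _) (*-congˡ (στ k))) (στ x))))

      τ-half : τ (σ (γ x) + k * σ k * σ x) ≈ γ x + τ k * k * x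
      τ-half = trans (τ.+-homo _ _) (+-cong (τσ _) (trans (τ.*-homo _ _)
        (*-cong (trans (τ.*-homo _ _) (*-congˡ (τσ k))) (τσ x))))

      hτky+γy : h * τ k * y + γ y ≈ τ (γ x) + h * τ k * τ x
      hτky+γy = trans (+-cong (first-half x) (γψ-scaled x)) (x+y-x≈y _ _)

      y+γhσhy : y + γ (h * σ h * y) ≈ - (σ (γ x) + k * σ k * σ x)
      y+γhσhy = begin
        y + γ (h * σ h * y)
          ≈⟨ +-congˡ (trans (γ.*-homo _ _) (*-congʳ (trans (γ.*-homo _ _) (*-cong γh≈-k γσh≈-σk)))) ⟩
        y + (- k * - σ k) * γ y
          ≈⟨ +-congˡ (*-cong (trans (sym (-‿distribˡ-* _ _)) (trans (-‿cong (sym (-‿distribʳ-* _ _))) (-‿involutive _)))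
                             (γψ-scaled x)) ⟩
        y + k * σ k * - V x
          ≈⟨ +-congˡ (trans (sym (-‿distribʳ-* _ _)) (-‿cong (second-half x))) ⟩
        y + - (y + (σ (γ x) + k * σ k * σ x))
          ≈⟨ +-congˡ (-‿+-comm _ _) ⟨
        y + (- y + - (σ (γ x) + k * σ k * σ x))
          ≈⟨ trans (sym (+-assoc _ _ _)) (trans (+-congʳ (-‿inverseʳ y)) (+-identityˡ _)) ⟩
        - (σ (γ x) + k * σ k * σ x) ∎

    -- An explicit inverse of the scalar c: it permits cancelling c and recovers coefficients in the
    -- backward inclusion.
    scale-inverse : k * (σ h + - τ k) * (- (h * β)) ≈ 1#
    scale-inverse = begin
      k * (σ h + - τ k) * (- (h * β))         ≈⟨ -‿distribʳ-* _ _ ⟨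
      - (k * (σ h + - τ k) * (h * β))         ≈⟨ -‿cong (solve 4 (λ h k β e → k :* e :* (h :* β) := h :* k :* (β :* e)) refl _ _ _ _) ⟩
      - (h * k * (β * (σ h + - τ k)))         ≈⟨ -‿cong (trans (*-congʳ hk≈1) (*-identityˡ _)) ⟩
      - (β * (σ h + - τ k))                   ≈⟨ -‿distribʳ-* _ _ ⟩
      β * (- (σ h + - τ k))                   ≈⟨ *-congˡ (trans (sym (-‿+-comm _ _)) (trans (+-congˡ (-‿involutive _)) (+-comm _ _))) ⟩
      β * (τ k + - σ h)                       ≈⟨ β-inverse ⟩
      1#                                      ∎

-- Evaluation of q-polynomials and of their adjoints, monomial by monomial.

negFin-nonZero : ∀ {n} (j : Fin n) → toℕ j ≢ 0 → toℕ (negFin j) ≡ n ∸ toℕ j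
negFin-nonZero {suc n} Fin.zero    0≢0 = contradiction ≡.refl 0≢0
negFin-nonZero {suc n} (Fin.suc i) _ = ≡.trans (Fin.opposite-prop (Fin.inject₁ i))
  (≡.cong (λ j → suc n ∸ suc j) (Fin.toℕ-inject₁ i))

-- The map j ↦ n - j is its own inverse away from 0; `negFin` fixes index 0, where n - 0 would be
-- out of range, and 0 < k excludes it.
toℕ-negFin≡⇒ : ∀ {n k} (j : Fin n) → 0 < k → toℕ (negFin j) ≡ k → toℕ j ≡ n ∸ k
toℕ-negFin≡⇒ {suc n} Fin.zero (s≤s z≤n) ()
toℕ-negFin≡⇒ {n} j@(Fin.suc _) _ eq = ≡.trans (≡.sym (ℕ.m∸[m∸n]≡n (ℕ.<⇒≤ (Fin.toℕ<n j))))
  (≡.cong (n ∸_) (≡.trans (≡.sym (negFin-nonZero j λ ())) eq))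

module QPolynomial {c ℓ} (R : CommutativeRing c ℓ) (q : ℕ) where
  open CommutativeRing R
  open FF R
  open import Algebra.Properties.CommutativeSemiring.Exp commutativeSemiring
  open import Algebra.Properties.Semiring.Sum semiring
    using (sum; sum-cong-≋; ∑-distrib-+; *-distribˡ-sum)
  open import Relation.Binary.Reasoning.Setoid setoid

  pow≡^ : ∀ x n → pow x n ≡ x ^ n
  pow≡^ x zero    = ≡.refl
  pow≡^ x (suc n) = ≡.cong (x *_) (pow≡^ x n)

  pow≈^ : ∀ x n → pow x n ≈ x ^ n
  pow≈^ x n = reflexive (pow≡^ x n)

  pow-cong : ∀ {x y} n → x ≈ y → pow x n ≈ pow y n
  pow-cong n x≈y = trans (pow≈^ _ n) (trans (^-congˡ n x≈y) (sym (pow≈^ _ n)))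

  ∑≡sum : ∀ n f → ∑ n f ≡ sum f
  ∑≡sum zero    f = ≡.refl
  ∑≡sum (suc n) f = ≡.cong (f Fin.zero +_) (∑≡sum n (f ∘ Fin.suc))

  ∑-cong : ∀ n {f g} → (∀ i → f i ≈ g i) → ∑ n f ≈ ∑ n g
  ∑-cong n {f} {g} f≈g = begin
    ∑ n f  ≡⟨ ∑≡sum n f ⟩
    sum f  ≈⟨ sum-cong-≋ f≈g ⟩
    sum g  ≡⟨ ∑≡sum n g ⟨
    ∑ n g  ∎

  ∑-+ : ∀ n f g → ∑ n (λ i → f i + g i) ≈ ∑ n f + ∑ n g
  ∑-+ n f g = begin
    ∑ n (λ i → f i + g i)  ≡⟨ ∑≡sum n _ ⟩
    sum (λ i → f i + g i)  ≈⟨ ∑-distrib-+ f g ⟩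
    sum f + sum g          ≡⟨ ≡.cong₂ _+_ (∑≡sum n f) (∑≡sum n g) ⟨
    ∑ n f + ∑ n g          ∎

  ∑-*ˡ : ∀ n a f → ∑ n (λ i → a * f i) ≈ a * ∑ n f
  ∑-*ˡ n a f = begin
    ∑ n (λ i → a * f i)  ≡⟨ ∑≡sum n _ ⟩
    sum (λ i → a * f i)  ≈⟨ *-distribˡ-sum a f ⟨
    a * sum f            ≡⟨ ≡.cong (a *_) (∑≡sum n f) ⟨
    a * ∑ n f            ∎

  ∑-supported-at : ∀ n j f → (∀ i → i ≢ j → f i ≈ 0#) → ∑ n f ≈ f j
  ∑-supported-at n j f f≈0 = trans (reflexive (∑≡sum n f)) (sum-supported-at +-commutativeMonoid j f f≈0)

  at-≡ : ∀ {i k} v → i ≡ k → at i k v ≡ v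
  at-≡ {i} {k} v i≡k with i ℕ.≟ k
  ... | yes _   = ≡.refl
  ... | no  i≢k = contradiction i≡k i≢k

  at-≢ : ∀ {i k} v → i ≢ k → at i k v ≡ 0#
  at-≢ {i} {k} v i≢k with i ℕ.≟ k
  ... | yes i≡k = contradiction i≡k i≢k
  ... | no  _   = ≡.refl

  at-elsewhere : ∀ {n k} (k<n : k < n) v (i : Fin n) → i ≢ Fin.fromℕ< k<n → at (toℕ i) k v ≈ 0#
  at-elsewhere k<n v i i≢k = reflexive (at-≢ v λ eq → i≢k
    (Fin.toℕ-injective (≡.trans eq (≡.sym (Fin.toℕ-fromℕ< k<n)))))

  eval-cong : ∀ n f {x y} → x ≈ y → eval q n f x ≈ eval q n f y
  eval-cong n f x≈y = ∑-cong n λ i → *-congˡ (pow-cong (q ℕ.^ toℕ i) x≈y)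

  eval-+ : ∀ n f g x → eval q n (λ i → f i + g i) x ≈ eval q n f x + eval q n g x
  eval-+ n f g x = trans (∑-cong n λ i → distribʳ _ (f i) (g i)) (∑-+ n _ _)

  eval-lin : ∀ n a b f x → 0 < n → eval q n (lin a b f) x ≈ a * x + b * eval q n f x
  eval-lin (suc n) a b f x _ = begin
    (a + b * f Fin.zero) * X₀ + ∑ n (λ i → b * f (Fin.suc i) * X (Fin.suc i))
      ≈⟨ +-cong (distribʳ _ _ _) (∑-cong n λ i → *-assoc _ _ _) ⟩
    a * X₀ + b * f Fin.zero * X₀ + ∑ n (λ i → b * (f (Fin.suc i) * X (Fin.suc i)))
      ≈⟨ +-cong (+-cong (*-congˡ (*-identityʳ x)) (*-assoc _ _ _)) (∑-*ˡ n b _) ⟩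
    a * x + b * (f Fin.zero * X₀) + b * ∑ n (λ i → f (Fin.suc i) * X (Fin.suc i))
      ≈⟨ trans (+-assoc _ _ _) (+-congˡ (sym (distribˡ _ _ _))) ⟩
    a * x + b * eval q (suc n) f x ∎
    where
    X : Fin (suc n) → Carrier
    X i = pow x (q ℕ.^ toℕ i)
    X₀ = X Fin.zero

  eval-at : ∀ {n k} → k < n → ∀ v x → eval q n (λ i → at (toℕ i) k v) x ≈ v * x ^ (q ℕ.^ k)
  eval-at {n} {k} k<n v x = trans
    (∑-supported-at n (Fin.fromℕ< k<n) _ λ i i≢k →
      trans (*-congʳ (at-elsewhere k<n v i i≢k)) (zeroˡ _))
    (*-cong (reflexive (at-≡ v (Fin.toℕ-fromℕ< k<n)))
            (reflexive (≡.trans (≡.cong (λ j → pow x (q ℕ.^ j)) (Fin.toℕ-fromℕ< k<n)) (pow≡^ x (q ℕ.^ k)))))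

  module _ (frobenius : ∀ j → IsRingHomomorphism rawRing rawRing (_^ (q ℕ.^ j))) where
    private module φ j = IsRingHomomorphism (frobenius j)

    eval-adjoint-+ : ∀ n f g x →
      eval q n (adjoint q n (λ i → f i + g i)) x ≈ eval q n (adjoint q n f) x + eval q n (adjoint q n g) x
    eval-adjoint-+ n f g x = trans
      (∑-cong n λ i → *-congʳ (let e = q ℕ.^ toℕ i in
        trans (pow≈^ _ e) (trans (φ.+-homo (toℕ i) _ _) (sym (+-cong (pow≈^ _ e) (pow≈^ _ e))))))
      (eval-+ n _ _ x)

    -- The only nonzero coefficient of the adjoint is v^(q^(n-k)), at index n - k, and it merges
    -- with x^(q^(n-k)) into a single power.
    eval-adjoint-at : ∀ {n k} → 0 < k → k < n → ∀ v x →
      eval q n (adjoint q n (λ i → at (toℕ i) k v)) x ≈ (v * x) ^ (q ℕ.^ (n ∸ k))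
    eval-adjoint-at {n} {k} 0<k k<n v x = trans
      (∑-supported-at n j₀ _ λ j j≢j₀ → trans (*-congʳ (trans (pow≈^ _ (q ℕ.^ toℕ j))
        (trans (φ.⟦⟧-cong (toℕ j) (reflexive (at-≢ v λ eq → j≢j₀ (Fin.toℕ-injective
                  (≡.trans (toℕ-negFin≡⇒ j 0<k eq) (≡.sym toℕ-j₀))))))
               (φ.0#-homo (toℕ j)))))
        (zeroˡ _))
      (begin
        pow (at (toℕ (negFin j₀)) k v) (q ℕ.^ toℕ j₀) * pow x (q ℕ.^ toℕ j₀)
          ≈⟨ *-cong (trans (pow-cong (q ℕ.^ toℕ j₀) (reflexive (at-≡ v neg-j₀))) (pow≈^ v (q ℕ.^ toℕ j₀))) (pow≈^ x (q ℕ.^ toℕ j₀)) ⟩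
        v ^ (q ℕ.^ toℕ j₀) * x ^ (q ℕ.^ toℕ j₀)
          ≈⟨ φ.*-homo (toℕ j₀) v x ⟨
        (v * x) ^ (q ℕ.^ toℕ j₀)
          ≡⟨ ≡.cong (λ j → (v * x) ^ (q ℕ.^ j)) toℕ-j₀ ⟩
        (v * x) ^ (q ℕ.^ (n ∸ k)) ∎)
      where
      n∸k<n : n ∸ k < n
      n∸k<n = ℕ.∸-monoʳ-< 0<k (ℕ.<⇒≤ k<n)

      j₀ : Fin n
      j₀ = Fin.fromℕ< n∸k<n

      toℕ-j₀ : toℕ j₀ ≡ n ∸ k
      toℕ-j₀ = Fin.toℕ-fromℕ< n∸k<n

      neg-j₀ : toℕ (negFin j₀) ≡ k
      neg-j₀ = ≡.trans
        (negFin-nonZero j₀ λ eq → ℕ.<⇒≢ (ℕ.m<n⇒0<n∸m k<n) (≡.sym (≡.trans (≡.sym toℕ-j₀) eq)))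
        (≡.trans (≡.cong (n ∸_) toℕ-j₀) (ℕ.m∸[m∸n]≡n (ℕ.<⇒≤ k<n)))

-- Specialisation to h and t: nonvanishing of the denominator and the equivalence.

module _ {c ℓ} (R : CommutativeRing c ℓ) where
  open CommutativeRing R
  open FF R

  module PsiEquivalence
    (inv : Carrier → Carrier) (q t : ℕ) {p r : ℕ} (pp : Prime p) (q≡p^r : q ≡ p ℕ.^ r) (2∤p : ¬ 2 ∣ p)
    (t≥3 : t ≥ 3) (isField : IsFieldWithInv inv) (card : HasCardinality (q ℕ.^ (2 ℕ.* t)))
    (h : Carrier) (h^q^t≉h : ¬ pow h (q ℕ.^ t) ≈ h) (h^[q^t+1]≈-1 : pow h (q ℕ.^ t ℕ.+ 1) ≈ - 1#) where

    open FiniteField R inv isField card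
    open QPolynomial R q
    open import Algebra.Properties.Ring ring
    open import Algebra.Properties.CommutativeSemiring.Exp commutativeSemiring
    open import Algebra.Solver.Ring.NaturalCoefficients.Default commutativeSemiring
    open import Relation.Binary.Reasoning.Setoid setoid

    q^i≡p^[r*i] : ∀ i → q ℕ.^ i ≡ p ℕ.^ (r ℕ.* i)
    q^i≡p^[r*i] i = ≡.trans (≡.cong (ℕ._^ i) q≡p^r) (ℕ.^-*-assoc p r i)

    open Frobenius {p} {r ℕ.* (2 ℕ.* t)} pp (q^i≡p^[r*i] (2 ℕ.* t))

    n : ℕ
    n = 2 ℕ.* t

    φ : ℕ → Carrier → Carrier
    φ i x = x ^ (q ℕ.^ i)

    φ-hom : ∀ i → IsRingHomomorphism rawRing rawRing (φ i)
    φ-hom i = ≡.subst (λ e → IsRingHomomorphism rawRing rawRing (_^ e)) (≡.sym (q^i≡p^[r*i] i))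
      (^p^-isRingHomomorphism (r ℕ.* i))

    pow≈φ : ∀ i x → pow x (q ℕ.^ i) ≈ φ i x
    pow≈φ i x = pow≈^ x (q ℕ.^ i)

    module φ i = IsRingHomomorphism (φ-hom i)

    φ-∘ : ∀ i j {m} → i ℕ.+ j ≡ m → ∀ x → φ j (φ i x) ≈ φ m x
    φ-∘ i j ≡.refl x = trans (^-assocʳ x (q ℕ.^ i) (q ℕ.^ j))
      (reflexive (≡.cong (x ^_) (≡.sym (ℕ.^-distribˡ-+-* q i j))))

    φ-comm : ∀ i j x → φ i (φ j x) ≈ φ j (φ i x)
    φ-comm i j x = trans (φ-∘ j i (ℕ.+-comm j i) x) (sym (φ-∘ i j ≡.refl x))

    φ-n : ∀ x → φ n x ≈ x
    φ-n = x^N≈x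

    suc[t∸1] : suc (t ∸ 1) ≡ t
    suc[t∸1] = ℕ.m+[n∸m]≡n (ℕ.≤-trans (s≤s z≤n) t≥3)

    n≡[t∸1]+[t+1] : n ≡ (t ∸ 1) ℕ.+ (t ℕ.+ 1)
    n≡[t∸1]+[t+1] rewrite ≡.sym suc[t∸1] = lemma (t ∸ 1)
      where
      lemma : ∀ s → 2 ℕ.* suc s ≡ s ℕ.+ (suc s ℕ.+ 1)
      lemma = solve-∀

    1+[n∸1]≡n : 1 ℕ.+ (n ∸ 1) ≡ n
    1+[n∸1]≡n = ℕ.m+[n∸m]≡n (ℕ.≤-trans (s≤s z≤n) (ℕ.≤-trans t≥3 (ℕ.m≤m+n t (t ℕ.+ 0))))

    σ τ γ : Carrier → Carrier
    σ = φ 1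
    τ = φ (n ∸ 1)
    γ = φ t

    στ : ∀ x → σ (τ x) ≈ x
    στ x = trans (φ-∘ (n ∸ 1) 1 (≡.trans (ℕ.+-comm (n ∸ 1) 1) 1+[n∸1]≡n) x) (φ-n x)

    τσ : ∀ x → τ (σ x) ≈ x
    τσ x = trans (φ-∘ 1 (n ∸ 1) 1+[n∸1]≡n x) (φ-n x)

    γγ : ∀ x → γ (γ x) ≈ x
    γγ x = trans (φ-∘ t t (≡.cong (t ℕ.+_) (≡.sym (ℕ.+-identityʳ t))) x) (φ-n x)

    φ[t+1]≈σγ : ∀ x → φ (t ℕ.+ 1) x ≈ σ (γ x)
    φ[t+1]≈σγ x = sym (φ-∘ t 1 ≡.refl x)

    -- The exponents t - 1 and t + (n - 1) differ by n; σ raises the left side to γ x, and τ undoes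
    -- it.
    φ[t∸1]≈τγ : ∀ x → φ (t ∸ 1) x ≈ τ (γ x)
    φ[t∸1]≈τγ x = begin
      φ (t ∸ 1) x          ≈⟨ τσ _ ⟨
      τ (σ (φ (t ∸ 1) x))  ≈⟨ φ.⟦⟧-cong (n ∸ 1) (φ-∘ (t ∸ 1) 1 (≡.trans (ℕ.+-comm (t ∸ 1) 1) suc[t∸1]) x) ⟩
      τ (γ x)              ∎

    -1≉0 : ¬ - 1# ≈ 0#
    -1≉0 -1≈0 = 1≉0 (trans (sym (-‿involutive 1#)) (trans (-‿cong -1≈0) -0#≈0#))

    γh*h≈-1 : γ h * h ≈ - 1#
    γh*h≈-1 = begin
      γ h * h                ≈⟨ *-congˡ (*-identityʳ h) ⟨
      γ h * h ^ 1            ≈⟨ ^-homo-* h (q ℕ.^ t) 1 ⟨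
      h ^ (q ℕ.^ t ℕ.+ 1)    ≈⟨ pow≈^ h (q ℕ.^ t ℕ.+ 1) ⟨
      pow h (q ℕ.^ t ℕ.+ 1)  ≈⟨ h^[q^t+1]≈-1 ⟩
      - 1#                   ∎

    k : Carrier
    k = inv h

    hk≈1 : h * k ≈ 1#
    hk≈1 = *-inverseʳ λ h≈0 → -1≉0 (trans (sym γh*h≈-1) (trans (*-congˡ h≈0) (zeroʳ _)))

    γh≈-k : γ h ≈ - k
    γh≈-k = begin
      γ h            ≈⟨ *-identityʳ _ ⟨
      γ h * 1#       ≈⟨ *-congˡ hk≈1 ⟨
      γ h * (h * k)  ≈⟨ *-assoc _ _ _ ⟨
      γ h * h * k    ≈⟨ *-congʳ γh*h≈-1 ⟩
      - 1# * k       ≈⟨ -1*x≈-x k ⟩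
      - k            ∎

    φh*φk≈1 : ∀ i → φ i h * φ i k ≈ 1#
    φh*φk≈1 i = trans (sym (φ.*-homo i h k)) (trans (φ.⟦⟧-cong i hk≈1) (φ.1#-homo i))

    -- If h = 1/h then h = 1 or h = -1, and x ↦ x^(q^t) fixes both, against h lying outside the
    -- subfield.
    h≉k : ¬ h ≈ k
    h≉k h≈k with x²≈1⇒x≈±1 (trans (*-congˡ h≈k) hk≈1)
    ... | inj₁ h≈1  = h^q^t≉h (trans (pow≈φ t h) (trans (φ.⟦⟧-cong t h≈1) (trans (φ.1#-homo t) (sym h≈1))))
    ... | inj₂ h≈-1 = h^q^t≉h (trans (pow≈φ t h) (trans (φ.⟦⟧-cong t h≈-1)
      (trans (φ.-‿homo t 1#) (trans (-‿cong (φ.1#-homo t)) (sym h≈-1)))))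

    -- Multiplied by h this becomes 1 ≠ -1, where odd characteristic enters.
    k≉-k : ¬ k ≈ - k
    k≉-k k≈-k = 1≉-1 2∤p (begin
      1#         ≈⟨ hk≈1 ⟨
      h * k      ≈⟨ *-congˡ k≈-k ⟩
      h * - k    ≈⟨ -‿distribʳ-* h k ⟨
      - (h * k)  ≈⟨ -‿cong hk≈1 ⟩
      - 1#       ∎)

    -- If h^(q²) = 1/h, then the maps x ↦ x^(q^(2m)) send h alternately to h and 1/h. For odd t, m = t gives
    -- h = 1/h; for even t, m = t / 2 gives h^(q^t) = h or h^(q^t) = 1/h = - 1/h.
    φ₂h≉k : ¬ φ 2 h ≈ k
    φ₂h≉k φ₂h≈k = contra (orbit t)
      where
      φ₂k≈h : φ 2 k ≈ h
      φ₂k≈h = begin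
        φ 2 k            ≈⟨ *-identityˡ _ ⟨
        1# * φ 2 k       ≈⟨ *-congʳ hk≈1 ⟨
        h * k * φ 2 k    ≈⟨ *-assoc _ _ _ ⟩
        h * (k * φ 2 k)  ≈⟨ *-congˡ (trans (*-congʳ (sym φ₂h≈k)) (φh*φk≈1 2)) ⟩
        h * 1#           ≈⟨ *-identityʳ h ⟩
        h                ∎

      Orbit : ℕ → Set ℓ
      Orbit m = (∃ λ j → m ≡ 2 ℕ.* j × φ (2 ℕ.* m) h ≈ h) ⊎ (∃ λ j → m ≡ suc (2 ℕ.* j) × φ (2 ℕ.* m) h ≈ k)

      step : ∀ m {x y} → φ (2 ℕ.* m) h ≈ x → φ 2 x ≈ y → φ (2 ℕ.* suc m) h ≈ y
      step m {x} {y} eq eq′ = begin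
        φ (2 ℕ.* suc m) h    ≈⟨ φ-∘ (2 ℕ.* m) 2 (≡.trans (ℕ.+-comm (2 ℕ.* m) 2) (≡.sym (ℕ.*-suc 2 m))) h ⟨
        φ 2 (φ (2 ℕ.* m) h)  ≈⟨ φ.⟦⟧-cong 2 eq ⟩
        φ 2 x                ≈⟨ eq′ ⟩
        y                    ∎

      orbit : ∀ m → Orbit m
      orbit zero = inj₁ (0 , ≡.refl , *-identityʳ h)
      orbit (suc m) with orbit m
      ... | inj₁ (j , m≡2j   , eq) = inj₂ (j , ≡.cong suc m≡2j , step m eq φ₂h≈k)
      ... | inj₂ (j , m≡1+2j , eq) =
        inj₁ (suc j , ≡.trans (≡.cong suc m≡1+2j) (≡.sym (ℕ.*-suc 2 j)) , step m eq φ₂k≈h)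

      contra : Orbit t → ⊥
      contra (inj₂ (_ , _ , φₙh≈k)) = h≉k (trans (sym (φ-n h)) φₙh≈k)
      contra (inj₁ (j , t≡2j , _)) with orbit j
      ... | inj₁ (_ , _ , eq) = h^q^t≉h (trans (pow≈φ t h) (≡.subst (λ i → φ i h ≈ h) (≡.sym t≡2j) eq))
      ... | inj₂ (_ , _ , eq) = k≉-k (trans (sym (≡.subst (λ i → φ i h ≈ k) (≡.sym t≡2j) eq)) γh≈-k)

    β : Carrier
    β = inv (τ k + - σ h)

    -- If τ k = σ h, applying σ gives k = h^(q²), which has been excluded.
    β-inverse : β * (τ k + - σ h) ≈ 1#
    β-inverse = *-inverseˡ λ e≈0 → φ₂h≉k (begin
      φ 2 h      ≈⟨ φ-∘ 1 1 ≡.refl h ⟨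
      σ (σ h)    ≈⟨ φ.⟦⟧-cong 1 (trans (+-inverseˡ-unique _ _ e≈0) (-‿involutive _)) ⟨
      σ (τ k)    ≈⟨ στ k ⟩
      k          ∎)

    open TwistedInverse R (φ-hom 1) (φ-hom (n ∸ 1)) (φ-hom t) στ τσ γγ
      (φ-comm t 1) (φ-comm t (n ∸ 1)) hk≈1 γh≈-k β-inverse

    inv-unique : ∀ {x y} → x * y ≈ 1# → inv x ≈ y
    inv-unique {x} {y} xy≈1 = *-cancelˡ-nonZero x≉0 (trans (*-inverseʳ x≉0) (sym xy≈1))
      where
      x≉0 : ¬ x ≈ 0#
      x≉0 x≈0 = 1≉0 (trans (sym xy≈1) (trans (*-congʳ x≈0) (zeroˡ y)))

    coeff[t+1]≈ : - (h * inv (pow h (q ℕ.^ (t ℕ.+ 1)))) ≈ h * σ h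
    coeff[t+1]≈ = begin
      - (h * inv (pow h (q ℕ.^ (t ℕ.+ 1))))  ≈⟨ -‿cong (*-congˡ (inv-unique inverse)) ⟩
      - (h * - σ h)                          ≈⟨ -‿distribʳ-* h (- σ h) ⟩
      h * - - σ h                            ≈⟨ *-congˡ (-‿involutive _) ⟩
      h * σ h                                ∎
      where
      inverse : pow h (q ℕ.^ (t ℕ.+ 1)) * - σ h ≈ 1#
      inverse = begin
        pow h (q ℕ.^ (t ℕ.+ 1)) * - σ h  ≈⟨ *-congʳ (trans (pow≈φ (t ℕ.+ 1) h) (φ[t+1]≈σγ h)) ⟩
        σ (γ h) * - σ h                  ≈⟨ *-cong (φ.⟦⟧-cong 1 γh≈-k) (sym (φ.-‿homo 1 h)) ⟩
        σ (- k) * σ (- h)                ≈⟨ φ.*-homo 1 _ _ ⟨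
        σ (- k * - h)                    ≈⟨ φ.⟦⟧-cong 1 (trans (sym (-‿distribˡ-* _ _))
                                              (trans (-‿cong (sym (-‿distribʳ-* _ _))) (-‿involutive _))) ⟩
        σ (k * h)                        ≈⟨ φ.⟦⟧-cong 1 (trans (*-comm k h) hk≈1) ⟩
        σ 1#                             ≈⟨ φ.1#-homo 1 ⟩
        1#                               ∎

    coeff[n∸1]≈ : h * inv (pow h (q ℕ.^ (n ∸ 1))) ≈ h * τ k
    coeff[n∸1]≈ = *-congˡ (inv-unique (trans (*-congʳ (pow≈φ (n ∸ 1) h)) (φh*φk≈1 (n ∸ 1))))

    0<t∸1 : 0 < t ∸ 1
    0<t∸1 = ℕ.m<n⇒0<n∸m (ℕ.≤-trans (s≤s (s≤s z≤n)) t≥3)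

    t+1<n : t ℕ.+ 1 < n
    t+1<n = ≡.subst (t ℕ.+ 1 <_) (≡.sym n≡[t∸1]+[t+1]) (ℕ.m<n+m (t ℕ.+ 1) 0<t∸1)

    0<t+1 : 0 < t ℕ.+ 1
    0<t+1 = ℕ.m≤n+m 1 t

    t∸1<n : t ∸ 1 < n
    t∸1<n = ≡.subst (t ∸ 1 <_) (≡.sym n≡[t∸1]+[t+1]) (ℕ.m<m+n (t ∸ 1) 0<t+1)

    1<n : 1 < n
    1<n = ℕ.≤-<-trans 0<t+1 t+1<n

    n∸1<n : n ∸ 1 < n
    n∸1<n = ℕ.∸-monoʳ-< (s≤s z≤n) (ℕ.<⇒≤ 1<n)

    f f̂ : QPoly n
    f = psi inv q t h
    f̂ = adjoint q n f

    eval-psi : ∀ x → eval q n f x ≈ ψ x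
    eval-psi x = begin
      eval q n f x
        ≈⟨ trans (eval-+ n _ _ x) (+-congʳ (trans (eval-+ n _ _ x) (+-congʳ (eval-+ n _ _ x)))) ⟩
      _ ≈⟨ +-cong (+-cong (+-cong (eval-at 1<n _ x) (eval-at t∸1<n _ x)) (eval-at t+1<n _ x)) (eval-at n∸1<n _ x) ⟩
      _ ≈⟨ +-cong (+-cong (+-cong (*-identityˡ _) (trans (*-identityˡ _) (φ[t∸1]≈τγ x)))
                          (*-cong coeff[t+1]≈ (φ[t+1]≈σγ x)))
                  (*-congʳ coeff[n∸1]≈) ⟩
      ψ x ∎

    eval-adjoint-psi : ∀ y → eval q n f̂ y ≈ ψ̂ y
    eval-adjoint-psi y = begin
      eval q n f̂ y
        ≈⟨ trans (eval-adjoint-+ φ-hom n (λ i → m₁ i + m₂ i + m₃ i) m₄ y) (+-congʳ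
             (trans (eval-adjoint-+ φ-hom n (λ i → m₁ i + m₂ i) m₃ y) (+-congʳ (eval-adjoint-+ φ-hom n m₁ m₂ y)))) ⟩
      _ ≈⟨ +-cong (+-cong (+-cong (eval-adjoint-at φ-hom (s≤s z≤n) 1<n _ y) (eval-adjoint-at φ-hom 0<t∸1 t∸1<n _ y))
                          (eval-adjoint-at φ-hom 0<t+1 t+1<n _ y))
                  (eval-adjoint-at φ-hom (ℕ.m<n⇒0<n∸m 1<n) n∸1<n _ y) ⟩
      _ ≈⟨ +-cong (+-cong (+-cong
             (φ.⟦⟧-cong (n ∸ 1) (*-identityˡ y))
             (trans (φ.⟦⟧-cong (n ∸ (t ∸ 1)) (*-identityˡ y)) (trans (φ-≡ n∸[t∸1]≡t+1) (φ[t+1]≈σγ y))))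
             (trans (φ.⟦⟧-cong (n ∸ (t ℕ.+ 1)) (*-congʳ coeff[t+1]≈)) (trans (φ-≡ n∸[t+1]≡t∸1) (φ[t∸1]≈τγ _))))
             (trans (φ.⟦⟧-cong (n ∸ (n ∸ 1)) (*-congʳ coeff[n∸1]≈)) (φ-≡ (ℕ.m∸[m∸n]≡n (ℕ.<⇒≤ 1<n)))) ⟩
      ψ̂ y ∎
      where
      monomial : ℕ → Carrier → QPoly n
      monomial i v j = at (toℕ j) i v

      m₁ m₂ m₃ m₄ : QPoly n
      m₁ = monomial 1 1#
      m₂ = monomial (t ∸ 1) 1#
      m₃ = monomial (t ℕ.+ 1) (- (h * inv (pow h (q ℕ.^ (t ℕ.+ 1)))))
      m₄ = monomial (n ∸ 1) (h * inv (pow h (q ℕ.^ (n ∸ 1))))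

      φ-≡ : ∀ {i j x} → i ≡ j → φ i x ≈ φ j x
      φ-≡ ≡.refl = refl

      n∸[t∸1]≡t+1 : n ∸ (t ∸ 1) ≡ t ℕ.+ 1
      n∸[t∸1]≡t+1 = ≡.trans (≡.cong (_∸ (t ∸ 1)) n≡[t∸1]+[t+1]) (ℕ.m+n∸m≡n (t ∸ 1) _)

      n∸[t+1]≡t∸1 : n ∸ (t ℕ.+ 1) ≡ t ∸ 1
      n∸[t+1]≡t∸1 = ≡.trans (≡.cong (_∸ (t ℕ.+ 1)) n≡[t∸1]+[t+1]) (ℕ.m+n∸n≡m (t ∸ 1) (t ℕ.+ 1))

    b b⁻¹ c₀ c₀⁻¹ : Carrier
    b    = k * β
    b⁻¹  = (τ k + - σ h) * h
    c₀   = k * (σ h + - τ k)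
    c₀⁻¹ = - (h * β)

    b⁻¹b≈1 : b⁻¹ * b ≈ 1#
    b⁻¹b≈1 = begin
      (τ k + - σ h) * h * (k * β)
        ≈⟨ solve 4 (λ e h k β → e :* h :* (k :* β) := h :* k :* (β :* e)) refl (τ k + - σ h) h k β ⟩
      h * k * (β * (τ k + - σ h))
        ≈⟨ trans (*-cong hk≈1 β-inverse) (*-identityˡ 1#) ⟩
      1# ∎

    L₁ L₂ : QPoly n
    L₁ = lin 1# 0# (λ _ → 0#)
    L₂ = lin 0# b f

    0<n : 0 < n
    0<n = ℕ.<-trans (s≤s z≤n) 1<n

    eval-L₁ : ∀ x → eval q n L₁ x ≈ x
    eval-L₁ x = trans (eval-lin n 1# 0# _ x 0<n)
      (trans (+-cong (*-identityˡ x) (zeroˡ _)) (+-identityʳ x))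

    eval-L₂ : ∀ x → eval q n L₂ x ≈ b * eval q n f x
    eval-L₂ x = trans (eval-lin n 0# b f x 0<n) (trans (+-congʳ (zeroˡ x)) (+-identityˡ _))

    eval-f̂-L₂ : ∀ x → eval q n f̂ (eval q n L₂ x) ≈ c₀ * x
    eval-f̂-L₂ x = begin
      eval q n f̂ (eval q n L₂ x)  ≈⟨ eval-cong n f̂ (trans (eval-L₂ x) (*-congˡ (eval-psi x))) ⟩
      eval q n f̂ (b * ψ x)        ≈⟨ eval-adjoint-psi _ ⟩
      ψ̂ (b * ψ x)                 ≈⟨ ψ̂-kβψ x ⟩
      c₀ * x                      ∎

    c₀-cancel : ∀ {x y} → c₀ * x ≈ c₀ * y → x ≈ y
    c₀-cancel eq = *-cancelˡ-nonZero
      (λ c₀≈0 → 1≉0 (trans (sym scale-inverse) (trans (*-congʳ c₀≈0) (zeroˡ _)))) eq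

    L₁-invertible : Invertible q n L₁
    L₁-invertible = (λ x y eq → trans (sym (eval-L₁ x)) (trans eq (eval-L₁ y))) , (λ y → y , eval-L₁ y)

    -- Up to the nonzero scalar `c₀`, the adjoint is a left inverse of `L₂`; surjectivity then
    -- follows from finiteness.
    L₂-injective : ∀ {x y} → eval q n L₂ x ≈ eval q n L₂ y → x ≈ y
    L₂-injective {x} {y} eq = c₀-cancel
      (trans (sym (eval-f̂-L₂ x)) (trans (eval-cong n f̂ eq) (eval-f̂-L₂ y)))

    L₂-invertible : Invertible q n L₂
    L₂-invertible = (λ _ _ → L₂-injective) , injective⇒surjective (eval-cong n L₂) L₂-injective

    eval-span-L₂ : ∀ a d x → eval q n (lin a d f̂) (eval q n L₂ x) ≈ eval q n (lin (d * c₀) (a * b) f) x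
    eval-span-L₂ a d x = begin
      eval q n (lin a d f̂) (eval q n L₂ x)
        ≈⟨ eval-lin n a d f̂ _ 0<n ⟩
      a * eval q n L₂ x + d * eval q n f̂ (eval q n L₂ x)
        ≈⟨ +-cong (*-congˡ (eval-L₂ x)) (*-congˡ (eval-f̂-L₂ x)) ⟩
      a * (b * eval q n f x) + d * (c₀ * x)
        ≈⟨ trans (+-comm _ _) (+-cong (sym (*-assoc _ _ _)) (sym (*-assoc _ _ _))) ⟩
      d * c₀ * x + a * b * eval q n f x
        ≈⟨ eval-lin n (d * c₀) (a * b) f x 0<n ⟨
      eval q n (lin (d * c₀) (a * b) f) x ∎

    id-isAut : IsAut id
    id-isAut = isRingIsomorphism rawRing refl

    equivalent : Equivalent q n (Span q n f̂) (Span q n f)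
    equivalent = L₁ , L₂ , id , L₁-invertible , L₂-invertible , id-isAut , forward , backward
      where
      forward : ∀ u → Span q n f̂ u → _
      forward u (a , d , u≈) = lin (d * c₀) (a * b) f , (d * c₀ , a * b , λ _ → refl) , λ x → begin
        eval q n (lin (d * c₀) (a * b) f) x              ≈⟨ eval-span-L₂ a d x ⟨
        eval q n (lin a d f̂) (eval q n L₂ x)             ≈⟨ u≈ _ ⟨
        eval q n u (eval q n L₂ x)                       ≈⟨ eval-L₁ _ ⟨
        eval q n L₁ (eval q n u (eval q n L₂ x))         ∎

      backward : ∀ v → Span q n f v → _
      -- Composition with `L₂` exchanges the two coefficients, so those of `u` solve a′ b = d and d′
      -- c₀ = a.
      backward v (a , d , v≈) = u , (d * b⁻¹ , a * c₀⁻¹ , λ _ → refl) , λ x → begin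
        eval q n v x
          ≈⟨ v≈ x ⟩
        eval q n (lin a d f) x
          ≈⟨ eval-lin n a d f x 0<n ⟩
        a * x + d * eval q n f x
          ≈⟨ +-cong (*-congʳ a≈) (*-congʳ d≈) ⟨
        a * c₀⁻¹ * c₀ * x + d * b⁻¹ * b * eval q n f x
          ≈⟨ eval-lin n _ _ f x 0<n ⟨
        eval q n (lin (a * c₀⁻¹ * c₀) (d * b⁻¹ * b) f) x
          ≈⟨ eval-span-L₂ (d * b⁻¹) (a * c₀⁻¹) x ⟨
        eval q n u (eval q n L₂ x)
          ≈⟨ eval-L₁ _ ⟨
        eval q n L₁ (eval q n u (eval q n L₂ x)) ∎
        where
        u : QPoly n
        u = lin (d * b⁻¹) (a * c₀⁻¹) f̂

        a≈ : a * c₀⁻¹ * c₀ ≈ a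
        a≈ = trans (*-assoc _ _ _) (trans (*-congˡ (trans (*-comm _ _) scale-inverse)) (*-identityʳ a))

        d≈ : d * b⁻¹ * b ≈ d
        d≈ = trans (*-assoc _ _ _) (trans (*-congˡ b⁻¹b≈1) (*-identityʳ d))

open import Data.Nat using (_^_; _*_; _+_)

theorem4p6 : {c ℓ : Level} (R : CommutativeRing c ℓ) (inv : CommutativeRing.Carrier R → CommutativeRing.Carrier R)
    (q t : ℕ) → IsPrimePower q → IsOdd q → t ≥ 3 →
    FF.IsFieldWithInv R inv → FF.HasCardinality R (q ^ (2 * t)) →
    (h : CommutativeRing.Carrier R) →
    ¬ (CommutativeRing._≈_ R (FF.pow R h (q ^ t)) h) →
    CommutativeRing._≈_ R (FF.pow R h (q ^ t + 1)) (CommutativeRing.-_ R (CommutativeRing.1# R)) →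
    FF.Equivalent R q (2 * t)
    (FF.Span R q (2 * t) (FF.adjoint R q (2 * t) (FF.psi R inv q t h)))
    (FF.Span R q (2 * t) (FF.psi R inv q t h))
-- The exponent is at least 1, so p divides q and the oddness of q passes to p.
theorem4p6 R inv q t (p , suc r , pp , s≤s _ , q≡p^r) 2∤q t≥3 isField card h h∉F h^≈-1 =
  PsiEquivalence.equivalent R inv q t {p} {suc r} pp q≡p^r
    (λ 2∣p → 2∤q (≡.subst (2 ∣_) (≡.sym q≡p^r) (∣m⇒∣m*n (p ^ r) 2∣p)))
    t≥3 isField card h h∉F h^≈-1
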